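{- For any simple connected graph $G$ with at least one edge, $src(G)\geq \chi'(G)\geq \omega'(G)$. Moreover, if an edge coloring $f$ of $G$ strongly rainbow connects $G$, then $f$ is a proper coloring of the vertices of the auxiliary graph $H(G)$.
   Context: An edge coloring of $G$ is any function $f:E(G)\to\{1,\dots,k\}$, $k\in\mathbb{N}$ (adjacent edges may share a color). A path is rainbow with respect to $f$ if its edges receive pairwise distinct colors. $f$ strongly rainbow connects $G$ if for every pair of distinct vertices $u,v$ there is a shortest $(u,v)$-path that is rainbow; $src(G)$ is the minimum $k$ for which such an $f:E(G)\to\{1,\dots,k\}$ exists. For distinct $u_1,u_2\in V(G)$, an edge $e$ separates $u_1,u_2$ if $e$ lies on every shortest $(u_1,u_2)$-path in $G$. The auxiliary graph $H(G)$ has vertex set $E(G)$, and two distinct edges $e_1,e_2\in E(G)$ are adjacent in $H(G)$ iff there exists a pair of distinct vertices $v_1,v_2\in V(G)$ separated by both $e_1$ and $e_2$. Define $\omega'(G)=\omega(H(G))$ (clique number) and $\chi'(G)=\chi(H(G))$ (chromatic number). Since $V(H(G))=E(G)$, an edge coloring of $G$ is a coloring of the vertices of $H(G)$. -}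

module Defs where

open import Data.Fin.Base as Fin using (Fin; zero; suc)
import Data.Fin.Properties as Fin
open import Data.List.Base using (List; []; _∷_; map; concatMap; length; lookup; allFin; _++_)
open import Data.List.Properties using (map-cong)
open import Data.List.Membership.Propositional using (_∈_; find; lose)
open import Data.List.Membership.Propositional.Properties
  using (∈-concatMap⁺; ∈-allFin; ∈-lookup; ∈-map⁺; ∈-++⁺ˡ; ∈-++⁺ʳ)
import Data.List.Membership.DecPropositional as DecMembership
open import Data.List.Relation.Unary.All as All using (All; []; _∷_)
open import Data.List.Relation.Unary.AllPairs using ([]; _∷_)
open import Data.List.Relation.Unary.Any as Any using (Any; here; there)
open import Data.List.Relation.Unary.Any.Properties using (lookup-index)
open import Data.List.Relation.Unary.Unique.Propositional using (Unique)
import Data.List.Relation.Unary.Unique.Propositional.Properties as Unique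
import Data.List.Relation.Unary.Unique.DecPropositional as DecUnique
open import Data.Nat.Base using (ℕ; zero; suc; _≤_; _<_; z≤n; s≤s; s≤s⁻¹)
import Data.Nat.Properties as ℕ
open import Data.Product.Base using (Σ; ∃; _×_; _,_; proj₁; proj₂)
open import Data.Sum.Base using (_⊎_; inj₁; inj₂)
open import Function.Base using (_∘_)
open import Function.Bundles using (_↪_; mk↪; RightInverse)
open import Function.Construct.Identity using (↪-id)
open import Function.Definitions using (Injective)
open import Relation.Binary.Definitions using (Symmetric; Irreflexive; Decidable; DecidableEquality)
open import Relation.Binary.PropositionalEquality
  using (_≡_; _≢_; _≗_; refl; sym; trans; cong; subst)
open import Relation.Nullary using (¬_; Dec; yes; no; contradiction; contradiction-irr; recompute)
open import Relation.Nullary.Decidable using (map′; ¬?; _×-dec_; _⊎-dec_; _→-dec_)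
import Relation.Unary as U

IsMinimum : (ℕ → Set) → ℕ → Set
IsMinimum P k = P k × (∀ j → P j → k ≤ j)

IsMaximum : (ℕ → Set) → ℕ → Set
IsMaximum P k = P k × (∀ j → P j → j ≤ k)

minimum : {P : ℕ → Set} → U.Decidable P → ∀ b → P b → ∃ (IsMinimum P)
minimum P? zero    p = zero , p , λ _ _ → z≤n
minimum {P} P? (suc b) p with P? zero
... | yes p₀ = zero , p₀ , λ _ _ → z≤n
... | no ¬p₀ with minimum {P ∘ suc} (P? ∘ suc) b p
...   | k , pk , least = suc k , pk , λ where
        zero    p₀ → contradiction p₀ ¬p₀
        (suc j) pj → s≤s (least j pj)

maximum : {P : ℕ → Set} → U.Decidable P → P 0 → ∀ b → (∀ j → P j → j ≤ b) → ∃ (IsMaximum P)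
maximum P? p₀ zero    bound = zero , p₀ , bound
maximum P? p₀ (suc b) bound with P? (suc b)
... | yes p = suc b , p , bound
... | no ¬p = maximum P? p₀ b λ j pj →
        s≤s⁻¹ (ℕ.≤∧≢⇒< (bound j pj) λ { refl → ¬p pj })

-- Being a retract of some Fin m is equivalent to being in bijection with some Fin m.
Finite : Set → Set
Finite A = ∃ λ m → A ↪ Fin m

module Finite {A : Set} (fin : Finite A) where

  size : ℕ
  size = proj₁ fin

  index : A → Fin size
  index = RightInverse.to (proj₂ fin)

  element : Fin size → A
  element = RightInverse.from (proj₂ fin)

  element-index : ∀ x → element (index x) ≡ x
  element-index = RightInverse.strictlyInverseʳ (proj₂ fin)

  index-injective : Injective _≡_ _≡_ index
  index-injective {x} {y} eq =
    trans (sym (element-index x)) (trans (cong element eq) (element-index y))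

  ∀? : {P : A → Set} → U.Decidable P → Dec (∀ x → P x)
  ∀? {P} P? = map′ (λ h x → subst P (element-index x) (h (index x))) (λ h → h ∘ element)
                   (Fin.all? (P? ∘ element))

  ∃? : {P : A → Set} → U.Decidable P → Dec (∃ P)
  ∃? {P} P? = map′ (λ (i , p) → element i , p)
                   (λ (x , p) → index x , subst P (sym (element-index x)) p)
                   (Fin.any? (P? ∘ element))

Fin-finite : ∀ {n} → Finite (Fin n)
Fin-finite {n} = n , ↪-id (Fin n)

list-finite : {A : Set} (xs : List A) → (∀ x → x ∈ xs) → Finite A
list-finite xs complete = length xs , mk↪ {to = Any.index ∘ complete} {from = lookup xs}
  λ { {x} refl → sym (lookup-index (complete x)) }

Respects-≗ : {A B : Set} → ((A → B) → Set) → Set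
Respects-≗ P = ∀ {f g} → f ≗ g → P f → P g

∃-function? : {A B : Set} → Finite A → Finite B → {P : (A → B) → Set} →
              Respects-≗ P → U.Decidable P → Dec (∃ P)
∃-function? {A} {B} finA finB = λ resp P? → map′
  (λ (g , p) → (λ x → g (FA.index x)) , p)
  (λ (f , p) → (λ i → f (FA.element i)) ,
               resp (λ x → cong f (sym (FA.element-index x))) p)
  (onFin _ (λ eq → resp (eq ∘ FA.index)) (λ g → P? (g ∘ FA.index)))
  where
  module FA = Finite finA
  module FB = Finite finB

  cons : ∀ {m} → B → (Fin m → B) → Fin (suc m) → B
  cons b g zero    = b
  cons b g (suc i) = g i

  onFin : ∀ m {P : (Fin m → B) → Set} → Respects-≗ P → U.Decidable P → Dec (∃ P)
  onFin zero {P} resp P? = map′ (λ p → none , p) (λ (_ , p) → resp (λ ()) p) (P? none)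
    where
    none : Fin 0 → B
    none ()
  onFin (suc m) {P} resp P? = map′
    (λ (b , g , p) → cons b g , p)
    (λ (f , p) → f zero , f ∘ suc , resp (λ { zero → refl ; (suc _) → refl }) p)
    (FB.∃? λ b → onFin m {λ g → P (cons b g)}
      (λ eq → resp λ { zero → refl ; (suc i) → eq i }) (λ g → P? (cons b g)))

record Graph (V : Set) : Set₁ where
  infix 4 _∼_ _∼?_
  field
    _∼_    : V → V → Set
    ∼-sym  : Symmetric _∼_
    irrefl : Irreflexive _≡_ _∼_
    _∼?_   : Decidable _∼_

module _ {V : Set} (G : Graph V) where
  open Graph G

  Proper : {C : Set} → (V → C) → Set
  Proper f = ∀ x y → x ∼ y → f x ≢ f y

  Colorable : ℕ → Set
  Colorable k = Σ (V → Fin k) Proper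

  IsClique : ∀ {k} → (Fin k → V) → Set
  IsClique c = ∀ i j → i ≢ j → c i ≢ c j × c i ∼ c j

  HasClique : ℕ → Set
  HasClique k = Σ (Fin k → V) IsClique

module _ {V : Set} (G : Graph V) (fin : Finite V) where
  open Graph G
  open Finite fin

  χ-minimum : ∃ (IsMinimum (Colorable G))
  χ-minimum = minimum colorable? size
    (index , λ x y x∼y eq → irrefl (index-injective eq) x∼y)
    where
    colorable? : U.Decidable (Colorable G)
    colorable? k = ∃-function? fin Fin-finite
      (λ eq proper x y x∼y e → proper x y x∼y (trans (eq x) (trans e (sym (eq y)))))
      (λ f → ∀? λ x → ∀? λ y → (x ∼? y) →-dec ¬? (f x Fin.≟ f y))

  ω-maximum : ∃ (IsMaximum (HasClique G))
  ω-maximum = maximum hasClique? ((λ ()) , λ ()) size bound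
    where
    _≟_ : DecidableEquality V
    x ≟ y = map′ index-injective (cong index) (index x Fin.≟ index y)

    resp : ∀ {k} → Respects-≗ (IsClique G {k})
    resp eq cl i j i≢j with cl i j i≢j
    ... | p rewrite eq i | eq j = p

    hasClique? : U.Decidable (HasClique G)
    hasClique? k = ∃-function? Fin-finite fin (resp {k})
      (λ c → Fin.all? λ i → Fin.all? λ j →
        ¬? (i Fin.≟ j) →-dec (¬? (c i ≟ c j) ×-dec (c i ∼? c j)))

    injective : ∀ {k} {c : Fin k → V} → IsClique G c → Injective _≡_ _≡_ (index ∘ c)
    injective cl {i} {j} eq with i Fin.≟ j
    ... | yes i≡j = i≡j
    ... | no  i≢j = contradiction (index-injective eq) (proj₁ (cl i j i≢j))

    bound : ∀ k → HasClique G k → k ≤ size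
    bound k (c , cl) = Fin.injective⇒≤ (injective cl)

  chromaticNumber : ℕ
  chromaticNumber = proj₁ χ-minimum

  cliqueNumber : ℕ
  cliqueNumber = proj₁ ω-maximum

-- An unordered pair of adjacent vertices, listed in increasing order so that each edge
-- has exactly one representation.
record Edge {n} (G : Graph (Fin n)) : Set where
  constructor edge
  open Graph G
  field
    lo hi  : Fin n
    .lo<hi : lo Fin.< hi
    .lo∼hi : lo ∼ hi

module _ {n} {G : Graph (Fin n)} where
  open Graph G
  open Edge

  infix 4 _≟ᴱ_

  _≟ᴱ_ : DecidableEquality (Edge G)
  e ≟ᴱ e′ = map′ (λ { (refl , refl) → refl }) (λ { refl → refl , refl })
                 ((lo e Fin.≟ lo e′) ×-dec (hi e Fin.≟ hi e′))

  edgesAt : Fin n → Fin n → List (Edge G)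
  edgesAt u v with u Fin.<? v | u ∼? v
  ... | yes u<v | yes u∼v = edge u v u<v u∼v ∷ []
  ... | no _    | _       = []
  ... | yes _   | no _    = []

  ∈-edgesAt : ∀ u v .(u<v : u Fin.< v) .(u∼v : u ∼ v) → edge u v u<v u∼v ∈ edgesAt u v
  ∈-edgesAt u v u<v u∼v with u Fin.<? v | u ∼? v
  ... | yes _   | yes _   = here refl
  ... | no ¬u<v | _       = contradiction-irr u<v ¬u<v
  ... | yes _   | no ¬u∼v = contradiction-irr u∼v ¬u∼v

  allEdges : List (Edge G)
  allEdges = concatMap (λ u → concatMap (edgesAt u) (allFin n)) (allFin n)

  ∈-allEdges : ∀ e → e ∈ allEdges
  ∈-allEdges (edge u v u<v u∼v) =
    ∈-concatMap⁺ _ (lose (∈-allFin u)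
      (∈-concatMap⁺ _ (lose (∈-allFin v) (∈-edgesAt u v u<v u∼v))))

  Joins : Edge G → Fin n → Fin n → Set
  Joins e u v = (lo e ≡ u × hi e ≡ v) ⊎ (lo e ≡ v × hi e ≡ u)

  joins? : ∀ e u v → Dec (Joins e u v)
  joins? e u v = ((lo e Fin.≟ u) ×-dec (hi e Fin.≟ v)) ⊎-dec ((lo e Fin.≟ v) ×-dec (hi e Fin.≟ u))

edges-finite : ∀ {n} (G : Graph (Fin n)) → Finite (Edge G)
edges-finite G = list-finite allEdges ∈-allEdges

module _ {n} (G : Graph (Fin n)) where

  infixr 5 _⟨_⟩∷_

  data Walk : Fin n → Fin n → Set where
    []     : ∀ {u} → Walk u u
    _⟨_⟩∷_ : ∀ {u v w} (e : Edge G) → .(Joins e u v) → Walk v w → Walk u w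

module _ {n} {G : Graph (Fin n)} where

  edges : ∀ {u v} → Walk G u v → List (Edge G)
  edges []           = []
  edges (e ⟨ _ ⟩∷ p) = e ∷ edges p

  vertices : ∀ {u v} → Walk G u v → List (Fin n)
  vertices {u} []           = u ∷ []
  vertices {u} (_ ⟨ _ ⟩∷ p) = u ∷ vertices p

  IsPath : ∀ {u v} → Walk G u v → Set
  IsPath p = Unique (vertices p)

  ∥_∥ : ∀ {u v} → Walk G u v → ℕ
  ∥ p ∥ = length (edges p)

  IsShortest : ∀ {u v} → Walk G u v → Set
  IsShortest {u} {v} p = IsPath p × (∀ (q : Walk G u v) → IsPath q → ∥ p ∥ ≤ ∥ q ∥)

  IsRainbow : {C : Set} → (Edge G → C) → ∀ {u v} → Walk G u v → Set
  IsRainbow f p = Unique (map f (edges p))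

module _ {n} (G : Graph (Fin n)) where

  Connected : Set
  Connected = ∀ u v → Σ (Walk G u v) IsPath

  StronglyRainbowConnects : {C : Set} → (Edge G → C) → Set
  StronglyRainbowConnects f =
    ∀ u v → u ≢ v → Σ (Walk G u v) λ p → IsShortest p × IsRainbow f p

  Separates : Edge G → Fin n → Fin n → Set
  Separates e u v = ∀ (p : Walk G u v) → IsShortest p → e ∈ edges p

module _ {n} {G : Graph (Fin n)} where
  open DecMembership (_≟ᴱ_ {G = G}) using (_∈?_)
  open DecUnique (Fin._≟_ {n}) using (unique?)

  -- A path in G has fewer than n edges, so paths range over a finite list; the
  -- resulting decision procedures are what make the extremal parameters constructively defined.
  prepend : ∀ {w} u v → List (Walk G v w) → Edge G → List (Walk G u w)
  prepend u v ps e with joins? e u v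
  ... | yes j = map (e ⟨ j ⟩∷_) ps
  ... | no  _ = []

  ∈-prepend : ∀ {w} u v {ps} e .(j : Joins e u v) {p : Walk G v w} →
              p ∈ ps → (e ⟨ j ⟩∷ p) ∈ prepend u v ps e
  ∈-prepend u v e j p∈ with joins? e u v
  ... | yes j′ = ∈-map⁺ (e ⟨ j′ ⟩∷_) p∈
  ... | no ¬j  = contradiction-irr j ¬j

  extend : ∀ {w} u → (∀ v → List (Walk G v w)) → Edge G → List (Walk G u w)
  extend u tails e = concatMap (λ v → prepend u v (tails v) e) (allFin n)

  ∈-extend : ∀ {w} u v tails e .(j : Joins e u v) {p : Walk G v w} →
             p ∈ tails v → (e ⟨ j ⟩∷ p) ∈ extend u tails e
  ∈-extend u v tails e j p∈ =
    ∈-concatMap⁺ _ (lose (∈-allFin v) (∈-prepend u v e j p∈))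

  nil : ∀ u w → List (Walk G u w)
  nil u w with u Fin.≟ w
  ... | yes refl = [] ∷ []
  ... | no _     = []

  ∈-nil : ∀ u → [] ∈ nil u u
  ∈-nil u with u Fin.≟ u
  ... | yes refl = here refl
  ... | no u≢u   = contradiction refl u≢u

  walks : ℕ → ∀ u w → List (Walk G u w)
  walks zero    u w = nil u w
  walks (suc l) u w = nil u w ++ concatMap (extend u (λ v → walks l v w)) allEdges

  ∈-walks : ∀ l {u w} (p : Walk G u w) → ∥ p ∥ ≤ l → p ∈ walks l u w
  ∈-walks zero    {u} []           _       = ∈-nil u
  ∈-walks (suc l) {u} []           _       = ∈-++⁺ˡ (∈-nil u)
  ∈-walks (suc l) {u} {w} (_⟨_⟩∷_ {v = v} e j p) (s≤s len) =
    ∈-++⁺ʳ (nil u w) (∈-concatMap⁺ _ (lose (∈-allEdges e)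
      (∈-extend u v (λ v → walks l v w) e j (∈-walks l p len))))

  lookup-injective : ∀ {A : Set} {xs : List A} → Unique xs → Injective _≡_ _≡_ (lookup xs)
  lookup-injective (_ ∷ _)    {zero}  {zero}  _  = refl
  lookup-injective (x≢ ∷ _)   {zero}  {suc j} eq = contradiction eq (All.lookup x≢ (∈-lookup j))
  lookup-injective (x≢ ∷ _)   {suc i} {zero}  eq = contradiction (sym eq) (All.lookup x≢ (∈-lookup i))
  lookup-injective (_ ∷ uniq) {suc i} {suc j} eq = cong suc (lookup-injective uniq eq)

  ∥∥<#vertices : ∀ {u w} (p : Walk G u w) → ∥ p ∥ < length (vertices p)
  ∥∥<#vertices []           = s≤s z≤n
  ∥∥<#vertices (_ ⟨ _ ⟩∷ p) = s≤s (∥∥<#vertices p)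

  ∈-paths : ∀ {u w} (p : Walk G u w) → IsPath p → p ∈ walks n u w
  ∈-paths p isPath = ∈-walks n p (ℕ.≤-trans (ℕ.<⇒≤ (∥∥<#vertices p))
                                            (Fin.injective⇒≤ (lookup-injective isPath)))

  isPath? : ∀ {u w} → U.Decidable (IsPath {G = G} {u} {w})
  isPath? p = unique? (vertices p)

  ∃-path? : ∀ {u w} {P : Walk G u w → Set} → (∀ p → P p → IsPath p) → U.Decidable P → Dec (∃ P)
  ∃-path? {u} {w} path P? = map′ (λ any → let p , _ , pp = find any in p , pp)
                                 (λ (p , pp) → lose (∈-paths p (path p pp)) pp)
                                 (Any.any? P? (walks n u w))

  ∀-path? : ∀ {u w} {P Q : Walk G u w → Set} → (∀ p → P p → IsPath p) →
            U.Decidable P → U.Decidable Q → Dec (∀ p → P p → Q p)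
  ∀-path? {u} {w} path P? Q? =
    map′ (λ all p pp → All.lookup all (∈-paths p (path p pp)) pp)
         (λ h → All.tabulate λ {p} _ → h p)
         (All.all? (λ p → P? p →-dec Q? p) (walks n u w))

  isShortest? : ∀ {u w} → U.Decidable (IsShortest {G = G} {u} {w})
  isShortest? p = isPath? p ×-dec ∀-path? (λ _ q → q) isPath? (λ q → ∥ p ∥ ℕ.≤? ∥ q ∥)

  separates? : ∀ e u v → Dec (Separates G e u v)
  separates? e u v = ∀-path? (λ _ → proj₁) isShortest? (λ p → e ∈? edges p)

  stronglyRainbowConnects? : ∀ {k} → U.Decidable (StronglyRainbowConnects G {Fin k})
  stronglyRainbowConnects? f = Fin.all? λ u → Fin.all? λ v → ¬? (u Fin.≟ v) →-dec
    ∃-path? (λ _ → proj₁ ∘ proj₁)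
            (λ p → isShortest? p ×-dec DecUnique.unique? Fin._≟_ (map f (edges p)))

  shortestPath : ∀ {u v} → Σ (Walk G u v) IsPath → Σ (Walk G u v) IsShortest
  shortestPath {u} {v} (p , isPath)
    with minimum (λ l → ∃-path? {P = λ q → IsPath q × ∥ q ∥ ≡ l} (λ _ → proj₁)
                                (λ q → isPath? q ×-dec (∥ q ∥ ℕ.≟ l)))
                 ∥ p ∥ (p , isPath , refl)
  ... | _ , (q , isPath-q , refl) , least = q , isPath-q , λ r isPath-r → least _ (r , isPath-r , refl)

  Incident : Fin n → Edge G → Set
  Incident u e = Edge.lo e ≡ u ⊎ Edge.hi e ≡ u

  joins⇒incident : ∀ {e u v} → Joins e u v → Incident u e × Incident v e
  joins⇒incident (inj₁ (p , q)) = inj₁ p , inj₂ q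
  joins⇒incident (inj₂ (p , q)) = inj₂ q , inj₁ p

  source∈ : ∀ {u w} (p : Walk G u w) → u ∈ vertices p
  source∈ []           = here refl
  source∈ (_ ⟨ _ ⟩∷ _) = here refl

  endpoint∈ : ∀ {u w} (p : Walk G u w) {e x} → e ∈ edges p → Incident x e → x ∈ vertices p
  endpoint∈ (_⟨_⟩∷_ {u} {v} e j p) (here refl) inc with recompute (joins? e u v) j | inc
  ... | inj₁ (refl , refl) | inj₁ refl = here refl
  ... | inj₁ (refl , refl) | inj₂ refl = there (source∈ p)
  ... | inj₂ (refl , refl) | inj₁ refl = there (source∈ p)
  ... | inj₂ (refl , refl) | inj₂ refl = here refl
  endpoint∈ (_ ⟨ _ ⟩∷ p) (there e∈) inc = there (endpoint∈ p e∈ inc)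

  edges-unique : ∀ {u w} (p : Walk G u w) → IsPath p → Unique (edges p)
  edges-unique []           _            = []
  edges-unique (_⟨_⟩∷_ {u} {v} e j p) (u≢ ∷ isPath) =
    All.tabulate (λ {e′} e′∈ e≡e′ →
      All.lookup u≢ (endpoint∈ p e′∈ (subst (Incident u) e≡e′
        (proj₁ (joins⇒incident {e} (recompute (joins? e u v) j))))) refl)
    ∷ edges-unique p isPath

module _ {n} (G : Graph (Fin n)) where

  StronglyRainbowColorable : ℕ → Set
  StronglyRainbowColorable k = Σ (Edge G → Fin k) (StronglyRainbowConnects G)

  -- For disconnected G no colouring strongly rainbow connects G, so the minimum does not exist.
  src-minimum : Connected G → ∃ (IsMinimum StronglyRainbowColorable)
  src-minimum connected = minimum colorable? size (index , injective)
    where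
    open Finite (edges-finite G)

    colorable? : U.Decidable StronglyRainbowColorable
    colorable? k = ∃-function? (edges-finite G) Fin-finite
      (λ eq src u v u≢v → let p , shortest , rainbow = src u v u≢v in
        p , shortest , subst Unique (map-cong eq (edges p)) rainbow)
      stronglyRainbowConnects?

    injective : StronglyRainbowConnects G index
    injective u v _ = let p , shortest = shortestPath (connected u v) in
      p , shortest , Unique.map⁺ index-injective (edges-unique p (proj₁ shortest))

  src : Connected G → ℕ
  src connected = proj₁ (src-minimum connected)

  H : Graph (Edge G)
  H = record
    { _∼_    = λ e₁ e₂ → e₁ ≢ e₂ × ∃ λ u → ∃ λ v → u ≢ v × Separates G e₁ u v × Separates G e₂ u v
    ; ∼-sym  = λ (e₁≢e₂ , u , v , u≢v , s₁ , s₂) → e₁≢e₂ ∘ sym , u , v , u≢v , s₂ , s₁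
    ; irrefl = λ e₁≡e₂ (e₁≢e₂ , _) → e₁≢e₂ e₁≡e₂
    ; _∼?_   = λ e₁ e₂ → ¬? (e₁ ≟ᴱ e₂) ×-dec
        Fin.any? λ u → Fin.any? λ v →
          ¬? (u Fin.≟ v) ×-dec (separates? e₁ u v ×-dec separates? e₂ u v)
    }

  χ′ : ℕ
  χ′ = chromaticNumber H (edges-finite G)

  ω′ : ℕ
  ω′ = cliqueNumber H (edges-finite G)

{-# OPTIONS --safe #-}
module Submission where

open import Defs
open import Data.Fin.Base using (Fin)
import Data.Fin.Properties as Fin
open import Data.List.Base using (List; map)
open import Data.List.Membership.Propositional using (_∈_)
open import Data.List.Membership.Propositional.Properties using (∈-map⁺)
open import Data.List.Relation.Unary.All as All using ()
open import Data.List.Relation.Unary.AllPairs using (_∷_)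
open import Data.List.Relation.Unary.Any using (here; there)
open import Data.List.Relation.Unary.Unique.Propositional using (Unique)
open import Data.Nat.Base using (_≤_; _≥_)
open import Data.Product.Base using (_×_; _,_; proj₁; proj₂)
open import Relation.Binary.PropositionalEquality using (_≡_; refl; sym)
open import Relation.Nullary using (yes; no; contradiction)

-- Two edges adjacent in `H G` both lie on every shortest path between some pair of vertices, in
-- particular on a rainbow one, so they get different colors. A strongly rainbow connecting coloring
-- is therefore proper on `H G`, which bounds the chromatic number by `src`. The clique bound is the
-- usual one: a proper coloring is injective on a clique.

-- Lets a rainbow path tell its edges apart by color.
unique-map⇒injective-on : {A B : Set} (f : A → B) {xs : List A} → Unique (map f xs) →
                          ∀ {x y} → x ∈ xs → y ∈ xs → f x ≡ f y → x ≡ y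
unique-map⇒injective-on f _          (here refl) (here refl) _  = refl
unique-map⇒injective-on f (fx≢ ∷ _)  (here refl) (there y∈)  eq =
  contradiction eq (All.lookup fx≢ (∈-map⁺ f y∈))
unique-map⇒injective-on f (fy≢ ∷ _)  (there x∈)  (here refl) eq =
  contradiction (sym eq) (All.lookup fy≢ (∈-map⁺ f x∈))
unique-map⇒injective-on f (_ ∷ uniq) (there x∈)  (there y∈)  eq =
  unique-map⇒injective-on f uniq x∈ y∈ eq

stronglyRainbow⇒proper : ∀ {n} (G : Graph (Fin n)) {C : Set} (f : Edge G → C) →
                         StronglyRainbowConnects G f → Proper (H G) f
stronglyRainbow⇒proper G f connects e₁ e₂ (e₁≢e₂ , u , v , u≢v , sep₁ , sep₂) eq =
  let p , shortest , rainbow = connects u v u≢v in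
  -- Separation speaks of all shortest paths, so it puts both edges on the rainbow path `p`.
  e₁≢e₂ (unique-map⇒injective-on f rainbow (sep₁ p shortest) (sep₂ p shortest) eq)

-- Pigeonhole: distinct clique members are adjacent, so `f` composed with `c` injects `Fin k` into
-- `Fin m`.
clique≤coloring : ∀ {V} (G : Graph V) {k m} → HasClique G k → Colorable G m → k ≤ m
clique≤coloring G (c , clique) (f , proper) = Fin.injective⇒≤ injective
  where
  injective : ∀ {i j} → f (c i) ≡ f (c j) → i ≡ j
  injective {i} {j} eq with i Fin.≟ j
  ... | yes i≡j = i≡j
  ... | no  i≢j = contradiction eq (proper (c i) (c j) (proj₂ (clique i j i≢j)))

cliqueNumber≤chromaticNumber : ∀ {V} (G : Graph V) (fin : Finite V) →
                               cliqueNumber G fin ≤ chromaticNumber G fin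
cliqueNumber≤chromaticNumber G fin =
  clique≤coloring G (proj₁ (proj₂ (ω-maximum G fin))) (proj₁ (proj₂ (χ-minimum G fin)))

χ′≤src : ∀ {n} (G : Graph (Fin n)) (connected : Connected G) → χ′ G ≤ src G connected
χ′≤src G connected =
  let k , (f , connects) , _ = src-minimum G connected
      _ , _ , least          = χ-minimum (H G) (edges-finite G)
  -- An optimal coloring for `src` competes in the minimum defining `χ′`.
  in least k (f , stronglyRainbow⇒proper G f connects)

theorem1 : ∀ {n} (G : Graph (Fin n)) (connected : Connected G) → Edge G →
           (src G connected ≥ χ′ G × χ′ G ≥ ω′ G) ×
           (∀ {k} (f : Edge G → Fin k) → StronglyRainbowConnects G f → Proper (H G) f)
theorem1 G connected _ =
  (χ′≤src G connected , cliqueNumber≤chromaticNumber (H G) (edges-finite G)) ,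
  stronglyRainbow⇒proper G
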